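{- Let $\mathcal A$ be a totally ordered finite alphabet with $|\mathcal A|>1$ and let $a=\min(\mathcal A)$. An $\mathcal A$-strict episturmian word $\mathbf t$ is an infinite Lyndon word if and only if $\mathbf t=a\mathbf s$ where $\mathbf s$ is an (aperiodic) $\mathcal A$-strict epistandard word. Moreover, if $\Delta=x_1x_2\cdots$ is the directive word of $\mathbf s$, then $\mathbf t=a\mathbf s$ is the unique episturmian word having the same set of factors as $\mathbf s$ that is directed by the spinned version of $\Delta$ in which every letter has spin $R$ except the letters $x_i=a$, which have spin $L$.
   Context: For $c\in\mathcal A$, $L_c,R_c$ are the morphisms with $L_c(c)=R_c(c)=c$, $L_c(d)=cd$, $R_c(d)=dc$ ($d\ne c$). Spinned words are words over $\mathcal A\cup\{\bar x:x\in\mathcal A\}$ (unbarred letters spin $L$, barred spin $R$); a spinned version of $x_1x_2\cdots$ is $\breve x_1\breve x_2\cdots$ with $\breve x_i\in\{x_i,\bar x_i\}$; $\mu_c=L_c$, $\mu_{\bar c}=R_c$. An infinite word is episturmian if its set of factors is closed under reversal and it has at most one right special factor of each length. A spinned infinite word $\breve x_1\breve x_2\cdots$ directs $\mathbf t$ if there are recurrent infinite words $\mathbf t^{(n)}$ with $\mathbf t^{(0)}=\mathbf t$, $\mathbf t^{(n-1)}=\mu_{\breve x_n}(\mathbf t^{(n)})$. $Pal$: $Pal(\varepsilon)=\varepsilon$, $Pal(ux)$ the shortest palindrome with prefix $Pal(u)x$; an epistandard word is $\mathbf s=\lim_nPal(x_1\cdots x_n)$ for $\Delta=x_1x_2\cdots\in\mathcal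 A^\omega$ (its directive word). An epistandard word $\mathbf s$, or any episturmian word with the same set of factors as $\mathbf s$, is $\mathcal A$-strict if every letter of $\mathcal A$ occurs infinitely often in $\Delta$. An infinite Lyndon word is an infinite word strictly lexicographically smaller than all its proper suffixes. -}

module Defs where

open import Data.Nat using (ℕ; zero; suc; _+_; _≤_; _<_)
open import Data.Fin using (Fin; zero; suc) renaming (_<_ to _<ᶠ_)
open import Data.Fin.Properties using () renaming (_≟_ to _≟ᶠ_)
open import Data.List using (List; []; _∷_; _++_; map; upTo; reverse; length; concatMap; _∷ʳ_)
open import Data.Product using (Σ; ∃; _×_; _,_)
open import Relation.Binary.PropositionalEquality using (_≡_; _≢_)
open import Relation.Nullary using (yes; no)
open import Function.Bundles using (_⇔_)

-- The alphabet is Fin k with its natural total order; its minimum is zero.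

Inf : Set → Set
Inf X = ℕ → X

pref : {X : Set} → Inf X → ℕ → List X
pref w n = map w (upTo n)

slice : {X : Set} → Inf X → ℕ → ℕ → List X
slice t i n = map (λ j → t (i + j)) (upTo n)

IsPrefixInf : {X : Set} → List X → Inf X → Set
IsPrefixInf p u = pref u (length p) ≡ p

IsPrefix : {X : Set} → List X → List X → Set
IsPrefix w q = ∃ λ r → w ++ r ≡ q

Factor : {X : Set} → List X → Inf X → Set
Factor w t = ∃ λ i → slice t i (length w) ≡ w

SameFactors : {X : Set} → Inf X → Inf X → Set
SameFactors t u = ∀ w → Factor w t ⇔ Factor w u

RightSpecial : {X : Set} → List X → Inf X → Set
RightSpecial w t = Σ _ λ x → Σ _ λ y → x ≢ y × Factor (w ∷ʳ x) t × Factor (w ∷ʳ y) t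

Episturmian : {X : Set} → Inf X → Set
Episturmian t =
  (∀ w → Factor w t → Factor (reverse w) t) ×
  (∀ u v → length u ≡ length v → RightSpecial u t → RightSpecial v t → u ≡ v)

Recurrent : {X : Set} → Inf X → Set
Recurrent t = ∀ i n → ∀ m → ∃ λ j → m < j × slice t j n ≡ slice t i n

Palindrome : {X : Set} → List X → Set
Palindrome p = reverse p ≡ p

ShortestPalExt : {X : Set} → List X → List X → Set
ShortestPalExt w p =
  Palindrome p × IsPrefix w p × (∀ q → Palindrome q → IsPrefix w q → length p ≤ length q)

-- graph of the map Pal
data PalRel {X : Set} : List X → List X → Set where
  pal-ε : PalRel [] []
  pal-snoc : ∀ {u p p′} x → PalRel u p → ShortestPalExt (p ∷ʳ x) p′ → PalRel (u ∷ʳ x) p′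

-- s = lim Pal(x_1 ⋯ x_n) where Δ = x_1 x_2 ⋯ (Δ 0 = x_1)
EpistandardDirectedBy : {X : Set} → Inf X → Inf X → Set
EpistandardDirectedBy s Δ = ∀ n → ∃ λ p → PalRel (pref Δ n) p × IsPrefixInf p s

StrictDirective : {k : ℕ} → Inf (Fin k) → Set
StrictDirective {k} Δ = ∀ (x : Fin k) (n : ℕ) → ∃ λ m → n ≤ m × Δ m ≡ x

StrictEpistandard : {k : ℕ} → Inf (Fin k) → Inf (Fin k) → Set
StrictEpistandard s Δ = StrictDirective Δ × EpistandardDirectedBy s Δ

StrictEpisturmian : {k : ℕ} → Inf (Fin k) → Set
StrictEpisturmian t = Episturmian t × (Σ _ λ s → Σ _ λ Δ → StrictEpistandard s Δ × SameFactors t s)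

_<lex_ : {k : ℕ} → Inf (Fin k) → Inf (Fin k) → Set
u <lex v = ∃ λ n → (∀ j → j < n → u j ≡ v j) × u n <ᶠ v n

InfLyndon : {k : ℕ} → Inf (Fin k) → Set
InfLyndon t = ∀ i → t <lex (λ j → t (suc i + j))

cons : {X : Set} → X → Inf X → Inf X
cons x s zero = x
cons x s (suc i) = s i

data Spin : Set where
  L R : Spin

μ : {k : ℕ} → Fin k × Spin → Fin k → List (Fin k)
μ (c , s) d with c ≟ᶠ d
... | yes _ = c ∷ []
μ (c , L) d | no _ = c ∷ d ∷ []
μ (c , R) d | no _ = d ∷ c ∷ []

-- u = μ(w) for infinite words (μ nonerasing): μ(prefix n of w) is a prefix of u for all n
IsImage : {k : ℕ} → (Fin k → List (Fin k)) → Inf (Fin k) → Inf (Fin k) → Set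
IsImage f w u = ∀ n → IsPrefixInf (concatMap f (pref w n)) u

Directs : {k : ℕ} → Inf (Fin k × Spin) → Inf (Fin k) → Set
Directs D t = Σ (ℕ → Inf _) λ T →
  (∀ i → T zero i ≡ t i) × (∀ n → Recurrent (T n)) × (∀ n → IsImage (μ (D n)) (T (suc n)) (T n))

spinMin : {k : ℕ} → Inf (Fin (suc k)) → Inf (Fin (suc k) × Spin)
spinMin Δ n with Δ n
... | zero = zero , L
... | suc x = suc x , R

{-# OPTIONS --safe #-}

-- Write φ_c(v) = L_c(v) c = c R_c(v). The map φ_c commutes with reversal, and cutting its values at block
-- boundaries shows that it sends longest palindromic suffixes to longest palindromic suffixes; this gives
-- Justin's formula Pal(c u) = φ_c(Pal(u)). Desubstitution along it shows that every left special factor of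
-- the epistandard word s is a prefix of s, and strictness that x p is a factor of s for every letter x and
-- every prefix p of s.
--
-- Hence a s is minimal in its subshift: if a factor a q y differs from the prefix a q x of a s at its last
-- letter, then a q is right special, its reversal is a prefix of s, so x = a < y. A Lyndon word of the
-- subshift is also minimal, hence equal to a s; conversely a s is strictly smaller than its suffixes,
-- because a period would force a and a second letter b to equal the same letter of s, as a p and b p occur
-- for every prefix p.
--
-- For the directive word, R_x(a w) = a L_x(w) for x ≠ a and L_a(a w) = a L_a(w), so a s is directed by the
-- given spins; since a occurs infinitely often, every word directed by them starts with a, and removing it
-- leaves a word directed by Δ with all spins L, that is s.

module Submission where

open import Defs
open import Data.Nat using (ℕ; zero; suc; _+_; _≤_; _<_; _⊔_; z≤n; s≤s)
open import Data.Nat.Properties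
open import Data.Fin using (Fin; zero; suc) renaming (_<_ to _<ᶠ_)
open import Data.Fin.Properties using () renaming (_≟_ to _≟ᶠ_; <-irrefl to <ᶠ-irrefl; <-asym to <ᶠ-asym)
open import Data.List using (List; []; _∷_; _++_; _∷ʳ_; reverse; length; concatMap; applyUpTo)
open import Data.List.Properties
open import Data.Product using (Σ; ∃; ∃₂; _×_; _,_; proj₁; proj₂)
open import Data.Sum using (_⊎_; inj₁; inj₂)
open import Data.Empty using (⊥-elim)
open import Function using (_∘_; _⇔_; mk⇔; Equivalence)
open import Relation.Binary.Definitions using (tri<; tri≈; tri>)
open import Relation.Binary.PropositionalEquality
open import Relation.Nullary using (yes; no)

private variable
  X : Set
  k : ℕ

-- The morphisms `L*` and `R*`, the map `φ` and its blocks

++-split : (u : List X) {v u′ v′ : List X} → u ++ v ≡ u′ ++ v′ → length u ≤ length u′ →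
  ∃ λ r → u′ ≡ u ++ r × v ≡ r ++ v′
++-split [] {u′ = u′} e _ = u′ , refl , e
++-split (x ∷ u) {u′ = y ∷ u′} e (s≤s l)
  with refl ← ∷-injectiveˡ e
  with r , e₁ , e₂ ← ++-split u {u′ = u′} (∷-injectiveʳ e) l = r , cong (x ∷_) e₁ , e₂

-- Chosen so that L_c(d) = c · tl c d and R_c(d) = tl c d · c.
tl : Fin k → Fin k → List (Fin k)
tl c d with c ≟ᶠ d
... | yes _ = []
... | no _  = d ∷ []

tl-cases : (c d : Fin k) → (c ≡ d × tl c d ≡ []) ⊎ (c ≢ d × tl c d ≡ d ∷ [])
tl-cases c d with c ≟ᶠ d
... | yes c≡d = inj₁ (c≡d , refl)
... | no c≢d  = inj₂ (c≢d , refl)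

L* R* φ : Fin k → List (Fin k) → List (Fin k)
L* c []      = []
L* c (d ∷ v) = c ∷ tl c d ++ L* c v
R* c []      = []
R* c (d ∷ v) = tl c d ++ c ∷ R* c v
φ c v = c ∷ R* c v

concatMap-L : (c : Fin k) (v : List (Fin k)) → concatMap (μ (c , L)) v ≡ L* c v
concatMap-L c [] = refl
concatMap-L c (d ∷ v) = cong₂ _++_ (μ-L d) (concatMap-L c v)
  where
  μ-L : ∀ d → μ (c , L) d ≡ c ∷ tl c d
  μ-L d with c ≟ᶠ d
  ... | yes _ = refl
  ... | no _  = refl

concatMap-R : (c : Fin k) (v : List (Fin k)) → concatMap (μ (c , R)) v ≡ R* c v
concatMap-R c [] = refl
concatMap-R c (d ∷ v) = trans (cong₂ _++_ (μ-R d) (concatMap-R c v)) (++-assoc (tl c d) (c ∷ []) (R* c v))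
  where
  μ-R : ∀ d → μ (c , R) d ≡ tl c d ++ c ∷ []
  μ-R d with c ≟ᶠ d
  ... | yes _ = refl
  ... | no _  = refl

L*-++ : (c : Fin k) (v w : List (Fin k)) → L* c (v ++ w) ≡ L* c v ++ L* c w
L*-++ c [] w = refl
L*-++ c (d ∷ v) w = cong (c ∷_) (trans (cong (tl c d ++_) (L*-++ c v w)) (sym (++-assoc (tl c d) _ _)))

R*-++ : (c : Fin k) (v w : List (Fin k)) → R* c (v ++ w) ≡ R* c v ++ R* c w
R*-++ c [] w = refl
R*-++ c (d ∷ v) w =
  trans (cong (λ z → tl c d ++ c ∷ z) (R*-++ c v w)) (sym (++-assoc (tl c d) _ _))

φ-++ᴸ : (c : Fin k) (v w : List (Fin k)) → φ c (v ++ w) ≡ L* c v ++ φ c w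
φ-++ᴸ c [] w = refl
φ-++ᴸ c (d ∷ v) w =
  cong (c ∷_) (trans (cong (tl c d ++_) (φ-++ᴸ c v w)) (sym (++-assoc (tl c d) _ _)))

φ-++ᴿ : (c : Fin k) (v w : List (Fin k)) → φ c (v ++ w) ≡ φ c v ++ R* c w
φ-++ᴿ c v w = cong (c ∷_) (R*-++ c v w)

φ-L* : (c : Fin k) (v : List (Fin k)) → φ c v ≡ L* c v ∷ʳ c
φ-L* c v = trans (cong (φ c) (sym (++-identityʳ v))) (φ-++ᴸ c v [])

reverse-tl : (c d : Fin k) → reverse (tl c d) ≡ tl c d
reverse-tl c d with c ≟ᶠ d
... | yes _ = refl
... | no _  = refl

-- Mirroring a block `c ∷ tl c d` moves its `c` to the end, because `tl c d` has at most one letter;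
-- blocks of `L*` thus become blocks of `R*`.
reverse-L* : (c : Fin k) (v : List (Fin k)) → reverse (L* c v) ≡ R* c (reverse v)
reverse-L* c [] = refl
reverse-L* c (d ∷ v) = begin
  reverse ((c ∷ tl c d) ++ L* c v)             ≡⟨ reverse-++ (c ∷ tl c d) (L* c v) ⟩
  reverse (L* c v) ++ reverse (c ∷ tl c d)     ≡⟨ cong₂ _++_ (reverse-L* c v)
                                                    (trans (unfold-reverse c (tl c d)) (cong (_∷ʳ c) (reverse-tl c d))) ⟩
  R* c (reverse v) ++ R* c (d ∷ [])            ≡⟨ R*-++ c (reverse v) (d ∷ []) ⟨
  R* c (reverse v ∷ʳ d)                        ≡⟨ cong (R* c) (unfold-reverse d v) ⟨
  R* c (reverse (d ∷ v))                       ∎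
  where open ≡-Reasoning

reverse-∷ʳ : (v : List X) (x : X) → reverse (v ∷ʳ x) ≡ x ∷ reverse v
reverse-∷ʳ v x = reverse-++ v (x ∷ [])

reverse-φ : (c : Fin k) (v : List (Fin k)) → reverse (φ c v) ≡ φ c (reverse v)
reverse-φ c v = trans (cong reverse (φ-L* c v)) (trans (reverse-∷ʳ (L* c v) c) (cong (c ∷_) (reverse-L* c v)))

tl++φ≢[] : (c d : Fin k) (v : List (Fin k)) → tl c d ++ φ c v ≢ []
tl++φ≢[] c d v e with () ← ++-conicalʳ (tl c d) _ e

-- The second letter of `φ c (d ∷ v)` is `d`, whether or not `d` equals `c`, and removing the first
-- block leaves `φ c v`; so the argument can be decoded from left to right.
φ-injective : (c : Fin k) (v w : List (Fin k)) → φ c v ≡ φ c w → v ≡ w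
φ-injective c [] [] e = refl
φ-injective c [] (d ∷ w) e = ⊥-elim (tl++φ≢[] c d w (sym (∷-injectiveʳ e)))
φ-injective c (d ∷ v) [] e = ⊥-elim (tl++φ≢[] c d v (∷-injectiveʳ e))
φ-injective c (d ∷ v) (d′ ∷ w) e with tl-cases c d | tl-cases c d′
... | inj₁ (refl , p) | inj₁ (refl , q) rewrite p =
  cong (c ∷_) (φ-injective c v w (∷-injectiveʳ e))
... | inj₁ (refl , p) | inj₂ (c≢d′ , q) rewrite p | q = ⊥-elim (c≢d′ (∷-injectiveˡ (∷-injectiveʳ e)))
... | inj₂ (c≢d , p) | inj₁ (refl , q) rewrite p | q = ⊥-elim (c≢d (sym (∷-injectiveˡ (∷-injectiveʳ e))))
... | inj₂ (c≢d , p) | inj₂ (c≢d′ , q) rewrite p | q =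
  cong₂ _∷_ (∷-injectiveˡ (∷-injectiveʳ e)) (φ-injective c v w (∷-injectiveʳ (∷-injectiveʳ e)))

φ-palindrome⁻ : (c : Fin k) (v : List (Fin k)) → Palindrome (φ c v) → Palindrome v
φ-palindrome⁻ c v e = φ-injective c (reverse v) v (trans (sym (reverse-φ c v)) e)

-- An occurrence of `c` in `φ c v` either opens a block or is the final letter, so a cut in front of
-- it falls on a block boundary.
cut-at-c : (c : Fin k) (p q v : List (Fin k)) → p ++ c ∷ q ≡ φ c v →
  ∃₂ λ v₁ v₂ → v ≡ v₁ ++ v₂ × p ≡ L* c v₁ × c ∷ q ≡ φ c v₂
cut-at-c c [] q v e = [] , v , refl , refl , e
cut-at-c c (x ∷ p) q [] e with () ← ++-conicalʳ p _ (∷-injectiveʳ e)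
cut-at-c c (x ∷ p) q (d ∷ v) e with tl-cases c d
... | inj₁ (refl , t) rewrite t
  with v₁ , v₂ , e₁ , e₂ , e₃ ← cut-at-c c p q v (∷-injectiveʳ e) =
  c ∷ v₁ , v₂ , cong (c ∷_) e₁ ,
  cong₂ _∷_ (∷-injectiveˡ e) (trans e₂ (cong (_++ L* c v₁) (sym t))) , e₃
cut-at-c c (x ∷ []) q (d ∷ v) e | inj₂ (c≢d , t) rewrite t =
  ⊥-elim (c≢d (∷-injectiveˡ (∷-injectiveʳ e)))
cut-at-c c (x ∷ y ∷ p) q (d ∷ v) e | inj₂ (c≢d , t) rewrite t
  with v₁ , v₂ , e₁ , e₂ , e₃ ← cut-at-c c p q v (∷-injectiveʳ (∷-injectiveʳ e)) =
  d ∷ v₁ , v₂ , cong (d ∷_) e₁ ,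
  cong₂ _∷_ (∷-injectiveˡ e)
    (trans (cong₂ _∷_ (∷-injectiveˡ (∷-injectiveʳ e)) e₂) (cong (_++ L* c v₁) (sym t))) , e₃

-- A letter `d` other than `c` occurs only as the second letter of a block `c d`. The `c` of that
-- block closes the left part, and the `c` that follows the block opens the right part, so both
-- parts are values of `φ c`.
cut-off-c : (c d : Fin k) → c ≢ d → (p q v : List (Fin k)) → p ++ d ∷ q ≡ φ c v →
  ∃₂ λ v₁ v₂ → v ≡ v₁ ++ d ∷ v₂ × p ≡ φ c v₁ × q ≡ φ c v₂
cut-off-c c d c≢d [] q v e = ⊥-elim (c≢d (sym (∷-injectiveˡ e)))
cut-off-c c d c≢d (x ∷ p) q [] e with () ← ++-conicalʳ p _ (∷-injectiveʳ e)
cut-off-c c d c≢d (x ∷ p) q (d′ ∷ v) e with tl-cases c d′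
... | inj₁ (refl , t) rewrite t
  with v₁ , v₂ , e₁ , e₂ , e₃ ← cut-off-c c d c≢d p q v (∷-injectiveʳ e) =
  c ∷ v₁ , v₂ , cong (c ∷_) e₁ ,
  cong₂ _∷_ (∷-injectiveˡ e) (trans e₂ (cong (_++ φ c v₁) (sym t))) , e₃
cut-off-c c d c≢d (x ∷ []) q (d′ ∷ v) e | inj₂ (c≢d′ , t) rewrite t
  with refl ← ∷-injectiveˡ (∷-injectiveʳ e) =
  [] , v , refl , cong (_∷ []) (∷-injectiveˡ e) , ∷-injectiveʳ (∷-injectiveʳ e)
cut-off-c c d c≢d (x ∷ y ∷ p) q (d′ ∷ v) e | inj₂ (c≢d′ , t) rewrite t
  with v₁ , v₂ , e₁ , e₂ , e₃ ← cut-off-c c d c≢d p q v (∷-injectiveʳ (∷-injectiveʳ e)) =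
  d′ ∷ v₁ , v₂ , cong (d′ ∷_) e₁ ,
  cong₂ _∷_ (∷-injectiveˡ e)
    (trans (cong₂ _∷_ (∷-injectiveˡ (∷-injectiveʳ e)) e₂) (cong (_++ φ c v₁) (sym t))) , e₃

-- Longest palindromic suffixes and palindromic closure

record LongestPalSuffix {X : Set} (w α β : List X) : Set where
  field
    split   : w ≡ α ++ β
    pal     : Palindrome β
    longest : ∀ α′ β′ → w ≡ α′ ++ β′ → Palindrome β′ → length α ≤ length α′

palindrome-wrap : (α β : List X) → Palindrome β → Palindrome (α ++ β ++ reverse α)
palindrome-wrap α β β-pal = begin
  reverse (α ++ β ++ reverse α)                 ≡⟨ reverse-++ α _ ⟩
  reverse (β ++ reverse α) ++ reverse α         ≡⟨ cong (_++ reverse α) (reverse-++ β _) ⟩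
  (reverse (reverse α) ++ reverse β) ++ reverse α ≡⟨ cong₂ (λ y z → (y ++ z) ++ reverse α) (reverse-involutive α) β-pal ⟩
  (α ++ β) ++ reverse α                         ≡⟨ ++-assoc α β _ ⟩
  α ++ β ++ reverse α                           ∎
  where open ≡-Reasoning

++-injective : (u : List X) {v u′ v′ : List X} → length u ≡ length u′ → u ++ v ≡ u′ ++ v′ → u ≡ u′
++-injective [] {u′ = []} _ _ = refl
++-injective (x ∷ u) {u′ = y ∷ u′} l e =
  cong₂ _∷_ (∷-injectiveˡ e) (++-injective u (suc-injective l) (∷-injectiveʳ e))

-- Write `p` as `w ++ r`. Since `α ++ β ++ reverse α` competes with `p`, `r` is at most as long as
-- `α`. As `p` is a palindrome, `w` begins with `reverse r`, and the rest of `w` is a palindromic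
-- suffix; maximality of `β` then forces `α` to be `reverse r`.
shortest-pal-ext : {w p α β : List X} → ShortestPalExt w p → LongestPalSuffix w α β →
  p ≡ α ++ β ++ reverse α
shortest-pal-ext {w = w} {α = α} {β} (p-pal , (r , refl) , p-min)
  record { split = refl ; pal = β-pal ; longest = longest } =
  trans (++-assoc α β r)
    (cong (λ z → α ++ β ++ z) (trans (sym (reverse-involutive r)) (cong reverse (sym α≡))))
  where
  r≤α : length (reverse r) ≤ length α
  r≤α = +-cancelˡ-≤ (length w) _ _ (begin
    length w + length (reverse r)       ≡⟨ cong (length w +_) (length-reverse r) ⟩
    length w + length r                 ≡⟨ length-++ w ⟨
    length (w ++ r)                     ≤⟨ p-min _ (palindrome-wrap α β β-pal) (reverse α , ++-assoc α β _) ⟩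
    length (α ++ β ++ reverse α)        ≡⟨ cong length (++-assoc α β _) ⟨
    length (w ++ reverse α)             ≡⟨ length-++ w ⟩
    length w + length (reverse α)       ≡⟨ cong (length w +_) (length-reverse α) ⟩
    length w + length α                 ∎)
    where open ≤-Reasoning
  r≤w : length (reverse r) ≤ length w
  r≤w = ≤-trans r≤α (≤-trans (m≤m+n _ (length β)) (≤-reflexive (sym (length-++ α))))
  α≡ : α ≡ reverse r
  α≡ with δ , w≡ , rev-w≡ ← ++-split (reverse r) {reverse w} {w} {r} (trans (sym (reverse-++ w r)) p-pal) r≤w =
    ++-injective α (≤-antisym (longest (reverse r) δ w≡ δ-pal) r≤α) w≡
    where
    open ≡-Reasoning
    δ-pal : Palindrome δ
    δ-pal = ++-cancelʳ r _ _ (begin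
      reverse δ ++ r                      ≡⟨ cong (reverse δ ++_) (reverse-involutive r) ⟨
      reverse δ ++ reverse (reverse r)    ≡⟨ reverse-++ (reverse r) δ ⟨
      reverse (reverse r ++ δ)            ≡⟨ cong reverse w≡ ⟨
      reverse w                           ≡⟨ rev-w≡ ⟩
      δ ++ r                              ∎)

-- Justin's formula

L*-length-mono : (c : Fin k) (α v₁ : List (Fin k)) {β v₂ : List (Fin k)} → α ++ β ≡ v₁ ++ v₂ →
  length α ≤ length v₁ → length (L* c α) ≤ length (L* c v₁)
L*-length-mono c α v₁ {β} {v₂} e l with δ , refl , _ ← ++-split α {β} {v₁} {v₂} e l = begin
  length (L* c α)                       ≤⟨ m≤m+n _ _ ⟩
  length (L* c α) + length (L* c δ)     ≡⟨ length-++ (L* c α) ⟨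
  length (L* c α ++ L* c δ)             ≡⟨ cong length (L*-++ c α δ) ⟨
  length (L* c (α ++ δ))                ∎
  where open ≤-Reasoning

palindrome-head : (α : List X) {w γ : List X} {x z : X} → w ∷ʳ x ≡ α ++ z ∷ γ → Palindrome (z ∷ γ) → x ≡ z
palindrome-head α {w} {γ} {x} {z} e p = ∷-injectiveˡ (begin
  x ∷ reverse w                  ≡⟨ reverse-∷ʳ w x ⟨
  reverse (w ∷ʳ x)               ≡⟨ cong reverse e ⟩
  reverse (α ++ z ∷ γ)           ≡⟨ reverse-++ α _ ⟩
  reverse (z ∷ γ) ++ reverse α   ≡⟨ cong (_++ reverse α) p ⟩
  z ∷ γ ++ reverse α             ∎)
  where open ≡-Reasoning

-- Pal, defined by Justin's formula; PalRel⇒P below identifies it with the palindromic closure.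
P : List (Fin k) → List (Fin k)
P []      = []
P (c ∷ u) = φ c (P u)

-- Used to carry a palindromic closure through `φ`: the two outer factors become `L*` and `R*`
-- images, which are mirror images of each other.
φ-wrap : (c : Fin k) (α β : List (Fin k)) →
  φ c (α ++ β ++ reverse α) ≡ L* c α ++ φ c β ++ reverse (L* c α)
φ-wrap c α β = begin
  φ c (α ++ β ++ reverse α)              ≡⟨ φ-++ᴸ c α _ ⟩
  L* c α ++ φ c (β ++ reverse α)         ≡⟨ cong (L* c α ++_) (φ-++ᴿ c β _) ⟩
  L* c α ++ φ c β ++ R* c (reverse α)    ≡⟨ cong (λ z → L* c α ++ φ c β ++ z) (reverse-L* c α) ⟨
  L* c α ++ φ c β ++ reverse (L* c α)    ∎
  where open ≡-Reasoning

tl-same : (c : Fin k) → tl c c ≡ []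
tl-same c with tl-cases c c
... | inj₁ (_ , e)   = e
... | inj₂ (c≢c , _) = ⊥-elim (c≢c refl)

tl-diff : {c d : Fin k} → c ≢ d → tl c d ≡ d ∷ []
tl-diff {c = c} {d} c≢d with tl-cases c d
... | inj₁ (c≡d , _) = ⊥-elim (c≢d c≡d)
... | inj₂ (_ , e)   = e

φ-∷ʳ-same : (c : Fin k) (w : List (Fin k)) → φ c (w ∷ʳ c) ≡ φ c w ∷ʳ c
φ-∷ʳ-same c w = trans (φ-++ᴿ c w (c ∷ [])) (cong (λ z → φ c w ++ z ++ c ∷ []) (tl-same c))

φ-∷ʳ-diff : {c d : Fin k} → c ≢ d → (w : List (Fin k)) → φ c (w ∷ʳ d) ≡ (φ c w ∷ʳ d) ∷ʳ c
φ-∷ʳ-diff {c = c} {d} c≢d w = begin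
  φ c (w ∷ʳ d)                   ≡⟨ φ-++ᴿ c w (d ∷ []) ⟩
  φ c w ++ tl c d ++ c ∷ []      ≡⟨ cong (λ z → φ c w ++ z ++ c ∷ []) (tl-diff c≢d) ⟩
  φ c w ++ d ∷ c ∷ []            ≡⟨ ++-assoc (φ c w) _ _ ⟨
  (φ c w ∷ʳ d) ∷ʳ c              ∎
  where open ≡-Reasoning

-- Every palindromic suffix of φ_c(w) c starts with c, hence at a block boundary.
lps-same : (c : Fin k) (w : List (Fin k)) {α β : List (Fin k)} → LongestPalSuffix (w ∷ʳ c) α β →
  LongestPalSuffix (φ c w ∷ʳ c) (L* c α) (φ c β)
lps-same c w {α} {β} record { split = split ; pal = pal ; longest = longest } = record
  { split   = trans (sym (φ-∷ʳ-same c w)) φ-split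
  ; pal     = trans (reverse-φ c β) (cong (φ c) pal)
  ; longest = longest′ }
  where
  φ-split : φ c (w ∷ʳ c) ≡ L* c α ++ φ c β
  φ-split = trans (cong (φ c) split) (φ-++ᴸ c α β)
  longest′ : ∀ α′ β′ → φ c w ∷ʳ c ≡ α′ ++ β′ → Palindrome β′ → length (L* c α) ≤ length α′
  -- The empty suffix is a palindrome as well; its complement is the whole word.
  longest′ α′ [] e _ = begin
    length (L* c α)                      ≤⟨ m≤m+n _ _ ⟩
    length (L* c α) + length (φ c β)     ≡⟨ length-++ (L* c α) ⟨
    length (L* c α ++ φ c β)             ≡⟨ cong length (trans (sym φ-split) (φ-∷ʳ-same c w)) ⟩
    length (φ c w ∷ʳ c)                  ≡⟨ cong length (trans e (++-identityʳ α′)) ⟩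
    length α′                            ∎
    where open ≤-Reasoning
  longest′ α′ (z ∷ γ) e p
    with refl ← palindrome-head α′ {φ c w} e p
    with v₁ , v₂ , e₁ , refl , e₃ ← cut-at-c c α′ γ (w ∷ʳ c) (trans (sym e) (sym (φ-∷ʳ-same c w))) =
    L*-length-mono c α v₁ (trans (sym split) e₁)
      (longest v₁ v₂ e₁ (φ-palindrome⁻ c v₂ (subst Palindrome e₃ p)))

palindrome-∷-∷ʳ : (c : X) (B : List X) → Palindrome B → Palindrome (c ∷ B ∷ʳ c)
palindrome-∷-∷ʳ c B = palindrome-wrap (c ∷ []) B

palindrome-∷-∷ʳ⁻ : (c : X) (B : List X) → Palindrome (c ∷ B ∷ʳ c) → Palindrome B
palindrome-∷-∷ʳ⁻ c B p = ++-cancelʳ (c ∷ []) _ _ (∷-injectiveʳ (begin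
  (c ∷ reverse B) ∷ʳ c           ≡⟨ cong (_∷ʳ c) (reverse-∷ʳ B c) ⟨
  reverse (B ∷ʳ c) ∷ʳ c          ≡⟨ unfold-reverse c (B ∷ʳ c) ⟨
  reverse (c ∷ B ∷ʳ c)           ≡⟨ p ⟩
  c ∷ B ∷ʳ c                     ∎))
  where open ≡-Reasoning

φ-∷-diff : {c d : Fin k} → c ≢ d → (v : List (Fin k)) → φ c (d ∷ v) ≡ c ∷ d ∷ φ c v
φ-∷-diff {c = c} c≢d v = cong (λ z → c ∷ z ++ φ c v) (tl-diff c≢d)

-- Palindromic suffixes of φ_c(w) d start with d, in the middle of a block c d; adding one c at both ends of
-- such a suffix gives a value of φ_c.
lps-diff : {c d : Fin k} → c ≢ d → (w : List (Fin k)) {α β : List (Fin k)} →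
  LongestPalSuffix (w ∷ʳ d) α β →
  ∃ λ B → LongestPalSuffix (φ c w ∷ʳ d) (φ c α) B × φ c β ≡ c ∷ B ∷ʳ c
-- An empty `β` is not longest, since the last letter `d` alone is a palindromic suffix.
lps-diff {d = d} c≢d w {α} {[]} record { split = split ; longest = longest } =
  ⊥-elim (<-irrefl refl (begin-strict
    length w          <⟨ n<1+n _ ⟩
    suc (length w)    ≡⟨ +-comm _ 1 ⟨
    length w + 1      ≡⟨ length-++ w ⟨
    length (w ∷ʳ d)   ≡⟨ cong length (trans split (++-identityʳ α)) ⟩
    length α          ≤⟨ longest w (d ∷ []) refl refl ⟩
    length w          ∎))
  where open ≤-Reasoning
lps-diff {c = c} {d} c≢d w {α} {z ∷ β} record { split = split ; pal = pal ; longest = longest }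
  with refl ← palindrome-head α {w} split pal =
  B , record
    { split = split′
    ; pal = palindrome-∷-∷ʳ⁻ c B
        (subst Palindrome φβ≡ (trans (reverse-φ c (d ∷ β)) (cong (φ c) pal)))
    ; longest = longest′ } , φβ≡
  where
  B = d ∷ L* c β
  φβ≡ : φ c (d ∷ β) ≡ c ∷ B ∷ʳ c
  φβ≡ = trans (φ-∷-diff c≢d β) (cong (λ z → c ∷ d ∷ z) (φ-L* c β))
  split′ : φ c w ∷ʳ d ≡ φ c α ++ B
  split′ = ++-cancelʳ (c ∷ []) _ _ (begin
    (φ c w ∷ʳ d) ∷ʳ c            ≡⟨ φ-∷ʳ-diff c≢d w ⟨
    φ c (w ∷ʳ d)                 ≡⟨ cong (φ c) split ⟩
    φ c (α ++ d ∷ β)             ≡⟨ φ-++ᴸ c α _ ⟩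
    L* c α ++ φ c (d ∷ β)        ≡⟨ cong (L* c α ++_) φβ≡ ⟩
    L* c α ++ c ∷ B ∷ʳ c         ≡⟨ ++-assoc (L* c α) (c ∷ []) _ ⟨
    (L* c α ∷ʳ c) ++ B ∷ʳ c      ≡⟨ cong (_++ B ∷ʳ c) (φ-L* c α) ⟨
    φ c α ++ B ∷ʳ c              ≡⟨ ++-assoc (φ c α) B _ ⟨
    (φ c α ++ B) ∷ʳ c            ∎)
    where open ≡-Reasoning
  longest′ : ∀ α′ β′ → φ c w ∷ʳ d ≡ α′ ++ β′ → Palindrome β′ → length (φ c α) ≤ length α′
  longest′ α′ [] e _ = begin
    length (φ c α)                       ≤⟨ m≤m+n _ _ ⟩
    length (φ c α) + length B            ≡⟨ length-++ (φ c α) ⟨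
    length (φ c α ++ B)                  ≡⟨ cong length split′ ⟨
    length (φ c w ∷ʳ d)                  ≡⟨ cong length (trans e (++-identityʳ α′)) ⟩
    length α′                            ∎
    where open ≤-Reasoning
  longest′ α′ (z ∷ γ) e p
    with refl ← palindrome-head α′ {φ c w} e p
    -- Appending `c` completes `φ c w ∷ʳ d` to `φ c (w ∷ʳ d)`, where the cut can be made;
    -- `c ∷ d ∷ γ ∷ʳ c` is then the palindrome `φ c (d ∷ v₂)`.
    with v₁ , v₂ , e₁ , refl , e₃ ← cut-off-c c d c≢d α′ (γ ∷ʳ c) (w ∷ʳ d)
           (trans (sym (++-assoc α′ (d ∷ γ) _)) (trans (cong (_∷ʳ c) (sym e)) (sym (φ-∷ʳ-diff c≢d w)))) = begin
    length (φ c α)         ≡⟨ lenφ α ⟩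
    length (L* c α) + 1    ≤⟨ +-monoˡ-≤ 1 (L*-length-mono c α v₁ (trans (sym split) e₁)
                                (longest v₁ (d ∷ v₂) e₁ (φ-palindrome⁻ c (d ∷ v₂) (subst Palindrome
                                  (trans (cong (λ z → c ∷ d ∷ z) e₃) (sym (φ-∷-diff c≢d v₂)))
                                  (palindrome-∷-∷ʳ c (d ∷ γ) p))))) ⟩
    length (L* c v₁) + 1   ≡⟨ lenφ v₁ ⟨
    length (φ c v₁)        ∎
    where
    open ≤-Reasoning
    lenφ : ∀ v → length (φ c v) ≡ length (L* c v) + 1
    lenφ v = trans (cong length (φ-L* c v)) (length-++ (L* c v))

-- Induction on the first letter `c`: applying `φ c` to the closure for the shorter word gives a
-- closure again. If `x` differs from `c`, the value `φ c β` exceeds the longest palindromic suffix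
-- by one `c` at each end, and these two letters are moved into the outer factors.
P-∷ʳ : (u : List (Fin k)) (x : Fin k) →
  ∃₂ λ α β → LongestPalSuffix (P u ∷ʳ x) α β × P (u ∷ʳ x) ≡ α ++ β ++ reverse α
P-∷ʳ [] x = [] , x ∷ [] , record { split = refl ; pal = refl ; longest = λ _ _ _ _ → z≤n } , refl
P-∷ʳ (c ∷ u) x with P-∷ʳ u x | c ≟ᶠ x
... | α , β , lps , e | yes refl =
  L* c α , φ c β , lps-same c (P u) lps , trans (cong (φ c) e) (φ-wrap c α β)
... | α , β , lps , e | no c≢x with B , lps′ , φβ≡ ← lps-diff c≢x (P u) lps =
  φ c α , B , lps′ , (begin
    φ c (P (u ∷ʳ x))                              ≡⟨ cong (φ c) e ⟩
    φ c (α ++ β ++ reverse α)                     ≡⟨ φ-wrap c α β ⟩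
    L* c α ++ φ c β ++ reverse (L* c α)           ≡⟨ cong (λ z → L* c α ++ z ++ reverse (L* c α)) φβ≡ ⟩
    L* c α ++ c ∷ (B ∷ʳ c) ++ reverse (L* c α)    ≡⟨ cong (λ z → L* c α ++ c ∷ z) (++-assoc B (c ∷ []) _) ⟩
    L* c α ++ c ∷ B ++ c ∷ reverse (L* c α)       ≡⟨ ++-assoc (L* c α) (c ∷ []) _ ⟨
    (L* c α ∷ʳ c) ++ B ++ c ∷ reverse (L* c α)    ≡⟨ cong₂ (λ y z → y ++ B ++ z) (φ-L* c α)
                                                     (trans (cong reverse (φ-L* c α)) (reverse-∷ʳ (L* c α) c)) ⟨
    φ c α ++ B ++ reverse (φ c α)                 ∎)
  where open ≡-Reasoning

PalRel⇒P : {u p : List (Fin k)} → PalRel u p → p ≡ P u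
PalRel⇒P pal-ε = refl
PalRel⇒P (pal-snoc {u} x rel ext) with refl ← PalRel⇒P rel | α , β , lps , e ← P-∷ʳ u x =
  trans (shortest-pal-ext ext lps) (sym e)

-- Palindromic prefixes and their left special factors

P-palindrome : (u : List (Fin k)) → Palindrome (P u)
P-palindrome []      = refl
P-palindrome (c ∷ u) = trans (reverse-φ c (P u)) (cong (φ c) (P-palindrome u))

P-prefix-∷ʳ : (u : List (Fin k)) (x : Fin k) → IsPrefix (P u ∷ʳ x) (P (u ∷ʳ x))
P-prefix-∷ʳ u x with α , β , lps , e ← P-∷ʳ u x =
  reverse α , trans (cong (_++ reverse α) (LongestPalSuffix.split lps)) (trans (++-assoc α β _) (sym e))

φ-prefix : (c : Fin k) {v w : List (Fin k)} → IsPrefix v w → IsPrefix (φ c v) (φ c w)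
φ-prefix c {v} (r , refl) = R* c r , sym (φ-++ᴿ c v r)

P-prefix-++ : (u v : List (Fin k)) → IsPrefix (P u) (P (u ++ v))
P-prefix-++ [] v      = P v , refl
P-prefix-++ (c ∷ u) v = φ-prefix c (P-prefix-++ u v)

R*-length : (c : Fin k) (v : List (Fin k)) → length v ≤ length (R* c v)
R*-length c [] = z≤n
R*-length c (d ∷ v) = begin
  suc (length v)                          ≤⟨ s≤s (R*-length c v) ⟩
  suc (length (R* c v))                   ≤⟨ m≤n+m _ (length (tl c d)) ⟩
  length (tl c d) + suc (length (R* c v)) ≡⟨ length-++ (tl c d) ⟨
  length (R* c (d ∷ v))                   ∎
  where open ≤-Reasoning

-- Ensures that the words `P` of longer and longer prefixes of a directive word reach every position
-- of the limit.
P-length : (u : List (Fin k)) → length u ≤ length (P u)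
P-length []      = z≤n
P-length (c ∷ u) = s≤s (≤-trans (P-length u) (R*-length c (P u)))

Fac : List X → List X → Set
Fac w v = ∃₂ λ p q → p ++ w ++ q ≡ v

-- The block of a letter `d` always ends in `d`, and a letter followed by `c` ends its block. Hence
-- `x` is itself a letter of `v`, and what follows it is read from `φ` of the rest of `v`.
desubstitute : (c x : Fin k) (w : List (Fin k)) (v : List (Fin k)) → Fac (x ∷ c ∷ w) (φ c v) →
  ∃₂ λ v₁ v₂ → v₁ ++ x ∷ v₂ ≡ v × IsPrefix (c ∷ w) (φ c v₂)
desubstitute c x w [] ([] , q , ())
desubstitute c x w [] (_ ∷ p , q , e) with () ← ++-conicalʳ p _ (∷-injectiveʳ e)
desubstitute c x w (d ∷ v) (p , q , e) with tl-cases c d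
desubstitute c x w (d ∷ v) ([] , q , e) | inj₁ (refl , t) rewrite t =
  [] , v , cong (_∷ v) (∷-injectiveˡ e) , q , ∷-injectiveʳ e
desubstitute c x w (d ∷ v) (_ ∷ p , q , e) | inj₁ (refl , t) rewrite t
  with v₁ , v₂ , refl , pre ← desubstitute c x w v (p , q , ∷-injectiveʳ e) = c ∷ v₁ , v₂ , refl , pre
desubstitute c x w (d ∷ v) ([] , q , e) | inj₂ (c≢d , t) rewrite t =
  ⊥-elim (c≢d (∷-injectiveˡ (∷-injectiveʳ e)))
desubstitute c x w (d ∷ v) (_ ∷ [] , q , e) | inj₂ (c≢d , t) rewrite t =
  [] , v , cong (_∷ v) (∷-injectiveˡ (∷-injectiveʳ e)) , q , ∷-injectiveʳ (∷-injectiveʳ e)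
desubstitute c x w (d ∷ v) (_ ∷ _ ∷ p , q , e) | inj₂ (c≢d , t) rewrite t
  with v₁ , v₂ , refl , pre ← desubstitute c x w v (p , q , ∷-injectiveʳ (∷-injectiveʳ e)) = d ∷ v₁ , v₂ , refl , pre

-- As long as `w` goes on after a `c`, its next letter determines the next letter of both preimages,
-- so they agree on a word `g`; a last `c` of `w` is covered by the `c` that ends `φ c g`.
common-prefix : (c : Fin k) (w v v′ : List (Fin k)) → IsPrefix w (φ c v) → IsPrefix w (φ c v′) →
  ∃ λ g → IsPrefix g v × IsPrefix g v′ × IsPrefix w (φ c g)
common-prefix c [] v v′ _ _ = [] , (v , refl) , (v′ , refl) , (φ c [] , refl)
common-prefix c (x ∷ []) v v′ (r , e) _ =
  [] , (v , refl) , (v′ , refl) , ([] , cong (_∷ []) (∷-injectiveˡ e))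
common-prefix c (x ∷ y ∷ w) (d ∷ v) (d′ ∷ v′) (r , e) (r′ , e′) with tl-cases c d | tl-cases c d′
... | inj₁ (refl , t) | inj₁ (refl , t′) rewrite t
  with g , (s , h) , (s′ , h′) , (z , pre) ← common-prefix c (y ∷ w) v v′ (r , ∷-injectiveʳ e) (r′ , ∷-injectiveʳ e′) =
  c ∷ g , (s , cong (c ∷_) h) , (s′ , cong (c ∷_) h′) ,
  (z , cong₂ _∷_ (∷-injectiveˡ e) (trans pre (cong (_++ φ c g) (sym t))))
... | inj₁ (refl , t) | inj₂ (c≢d′ , t′) rewrite t | t′ =
  ⊥-elim (c≢d′ (trans (sym (∷-injectiveˡ (∷-injectiveʳ e))) (∷-injectiveˡ (∷-injectiveʳ e′))))
... | inj₂ (c≢d , t) | inj₁ (refl , t′) rewrite t | t′ =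
  ⊥-elim (c≢d (trans (sym (∷-injectiveˡ (∷-injectiveʳ e′))) (∷-injectiveˡ (∷-injectiveʳ e))))
... | inj₂ (c≢d , t) | inj₂ (c≢d′ , t′) rewrite t | t′
  with refl ← ∷-injectiveˡ (∷-injectiveʳ e) | refl ← ∷-injectiveˡ (∷-injectiveʳ e′)
  with g , (s , h) , (s′ , h′) , (z , pre)
    ← common-prefix c w v v′ (r , ∷-injectiveʳ (∷-injectiveʳ e)) (r′ , ∷-injectiveʳ (∷-injectiveʳ e′)) =
  y ∷ g , (s , cong (y ∷_) h) , (s′ , cong (y ∷_) h′) ,
  (z , cong₂ _∷_ (∷-injectiveˡ e) (trans (cong (y ∷_) pre) (cong (_++ φ c g) (sym t))))
common-prefix c (x ∷ y ∷ w) [] v′ (r , ()) _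
common-prefix c (x ∷ y ∷ w) (d ∷ v) [] _ (r , ())

IsPrefix-trans : {u v w : List X} → IsPrefix u v → IsPrefix v w → IsPrefix u w
IsPrefix-trans {u = u} (r , refl) (r′ , refl) = r ++ r′ , sym (++-assoc u r r′)

φ-follows : (v : List (Fin k)) {c x z : Fin k} {w : List (Fin k)} → c ≢ x → Fac (x ∷ z ∷ w) (φ c v) → c ≡ z
φ-follows v {c} {x} {z} {w} c≢x (p , q , e)
  with _ , _ , _ , _ , e₃ ← cut-off-c c x c≢x p (z ∷ w ++ q) v e = sym (∷-injectiveˡ e₃)

-- One of `x` and `y` differs from `c`, and in `φ c v` such a letter is always followed by `c`.
φ-left-special : (c : Fin k) (v : List (Fin k)) {x y z : Fin k} {w : List (Fin k)} → x ≢ y →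
  Fac (x ∷ z ∷ w) (φ c v) → Fac (y ∷ z ∷ w) (φ c v) → c ≡ z
φ-left-special c v {x} x≢y fx fy with c ≟ᶠ x
... | yes refl = φ-follows v x≢y fy
... | no c≢x   = φ-follows v c≢x fx

-- Both occurrences desubstitute with the same left letters `x` and `y`, so the common prefix `g` of
-- what follows them is left special in `P u`. By induction `g` is a prefix of `P u`, and `w` is a
-- prefix of `φ c g`.
left-special-prefix : (u w : List (Fin k)) {x y : Fin k} → x ≢ y → Fac (x ∷ w) (P u) → Fac (y ∷ w) (P u) →
  IsPrefix w (P u)
left-special-prefix u [] x≢y _ _ = P u , refl
left-special-prefix [] (z ∷ w) x≢y ([] , q , ()) _
left-special-prefix [] (z ∷ w) x≢y (_ ∷ p , q , ()) _
left-special-prefix (c ∷ u) (z ∷ w) {x} {y} x≢y fx fy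
  with refl ← φ-left-special c (P u) x≢y fx fy
  with v₁ , v₂ , ex , px ← desubstitute c x w (P u) fx
  with v₃ , v₄ , ey , py ← desubstitute c y w (P u) fy
  with g , (r , refl) , (r′ , refl) , pg ← common-prefix c (c ∷ w) v₂ v₄ px py =
  IsPrefix-trans pg (φ-prefix c (left-special-prefix u g x≢y (v₁ , r , ex) (v₃ , r′ , ey)))

-- Prefixes and factors of infinite words

Pre : List X → Inf X → Set
Pre w s = applyUpTo s (length w) ≡ w

Pre⇒IsPrefixInf : (w : List X) (s : Inf X) → Pre w s → IsPrefixInf w s
Pre⇒IsPrefixInf w s = trans (map-upTo s (length w))

IsPrefixInf⇒Pre : (w : List X) (s : Inf X) → IsPrefixInf w s → Pre w s
IsPrefixInf⇒Pre w s = trans (sym (map-upTo s (length w)))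

Pre⇒Factor : (w : List X) (s : Inf X) (i : ℕ) → Pre w (λ j → s (i + j)) → Factor w s
Pre⇒Factor w s i e = i , trans (map-upTo (λ j → s (i + j)) (length w)) e

Factor⇒Pre : (w : List X) (s : Inf X) → Factor w s → ∃ λ i → Pre w (λ j → s (i + j))
Factor⇒Pre w s (i , e) = i , trans (sym (map-upTo (λ j → s (i + j)) (length w))) e

Pre-applyUpTo : (s : Inf X) (n : ℕ) → Pre (applyUpTo s n) s
Pre-applyUpTo s n = cong (applyUpTo s) (length-applyUpTo s n)

applyUpTo-+ : (f : Inf X) (m n : ℕ) → applyUpTo f (m + n) ≡ applyUpTo f m ++ applyUpTo (λ j → f (m + j)) n
applyUpTo-+ f zero n    = refl
applyUpTo-+ f (suc m) n = cong (f 0 ∷_) (applyUpTo-+ (f ∘ suc) m n)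

applyUpTo-cong : {f g : Inf X} (n : ℕ) → (∀ j → j < n → f j ≡ g j) → applyUpTo f n ≡ applyUpTo g n
applyUpTo-cong zero h    = refl
applyUpTo-cong (suc n) h = cong₂ _∷_ (h 0 (s≤s z≤n)) (applyUpTo-cong n (λ j l → h (suc j) (s≤s l)))

applyUpTo-≡⁻ : {f g : Inf X} (n : ℕ) → applyUpTo f n ≡ applyUpTo g n → ∀ j → j < n → f j ≡ g j
applyUpTo-≡⁻ (suc n) e zero l          = ∷-injectiveˡ e
applyUpTo-≡⁻ (suc n) e (suc j) (s≤s l) = applyUpTo-≡⁻ n (∷-injectiveʳ e) j l

Pre-++ˡ : (v r : List X) (s : Inf X) → Pre (v ++ r) s → Pre v s
Pre-++ˡ [] r s e      = refl
Pre-++ˡ (x ∷ v) r s e = cong₂ _∷_ (∷-injectiveˡ e) (Pre-++ˡ v r (s ∘ suc) (∷-injectiveʳ e))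

Pre-++ʳ : (p v : List X) (s : Inf X) → Pre (p ++ v) s → Pre v (λ j → s (length p + j))
Pre-++ʳ [] v s e      = e
Pre-++ʳ (x ∷ p) v s e = Pre-++ʳ p v (s ∘ suc) (∷-injectiveʳ e)

Pre-prefix : {v w : List X} {s : Inf X} → IsPrefix v w → Pre w s → Pre v s
Pre-prefix {v = v} {s = s} (r , refl) = Pre-++ˡ v r s

Fac⇒Factor : {v w : List X} {s : Inf X} → Fac v w → Pre w s → Factor v s
Fac⇒Factor {v = v} {s = s} (p , q , refl) e =
  Pre⇒Factor v s (length p) (Pre-++ˡ v q (λ j → s (length p + j)) (Pre-++ʳ p (v ++ q) s e))

applyUpTo-prefix : {n : ℕ} {v : List X} {s : Inf X} → Pre v s → n ≤ length v → IsPrefix (applyUpTo s n) v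
applyUpTo-prefix {n = n} {s = s} e l with d , n+d≡ ← m≤n⇒∃[o]m+o≡n l =
  applyUpTo (λ j → s (n + j)) d , trans (sym (applyUpTo-+ s n d)) (trans (cong (applyUpTo s) n+d≡) e)

Pre⇒Fac : {w v : List X} {s : Inf X} (i : ℕ) → Pre w (λ j → s (i + j)) → Pre v s → i + length w ≤ length v → Fac w v
Pre⇒Fac {w = w} {s = s} i ew ev l with r , e ← applyUpTo-prefix ev l =
  applyUpTo s i , r , (begin
    applyUpTo s i ++ w ++ r                                        ≡⟨ cong (λ z → applyUpTo s i ++ z ++ r) ew ⟨
    applyUpTo s i ++ applyUpTo (λ j → s (i + j)) (length w) ++ r   ≡⟨ ++-assoc (applyUpTo s i) _ r ⟨
    (applyUpTo s i ++ applyUpTo (λ j → s (i + j)) (length w)) ++ r ≡⟨ cong (_++ r) (applyUpTo-+ s i (length w)) ⟨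
    applyUpTo s (i + length w) ++ r                                ≡⟨ e ⟩
    _                                                              ∎)
  where open ≡-Reasoning

Fac-prefix : {w u v : List X} → IsPrefix u v → Fac w u → Fac w v
Fac-prefix {w = w} (r , refl) (p , q , refl) =
  p , q ++ r , trans (cong (p ++_) (sym (++-assoc w q r))) (sym (++-assoc p (w ++ q) r))

Fac-reverse : {w v : List X} → Palindrome v → Fac w v → Fac (reverse w) v
Fac-reverse {w = w} v-pal (p , q , refl) = reverse q , reverse p , (begin
  reverse q ++ reverse w ++ reverse p    ≡⟨ ++-assoc (reverse q) _ _ ⟨
  (reverse q ++ reverse w) ++ reverse p  ≡⟨ cong (_++ reverse p) (reverse-++ w q) ⟨
  reverse (w ++ q) ++ reverse p          ≡⟨ reverse-++ p (w ++ q) ⟨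
  reverse (p ++ w ++ q)                  ≡⟨ v-pal ⟩
  p ++ w ++ q                            ∎)
  where open ≡-Reasoning

palindrome-suffix : {v w : List X} → Palindrome w → IsPrefix v w → ∃ λ r → r ++ reverse v ≡ w
palindrome-suffix {v = v} w-pal (r , refl) = reverse r , trans (sym (reverse-++ v r)) w-pal

length-slice : (t : Inf X) (i n : ℕ) → length (slice t i n) ≡ n
length-slice t i n = trans (cong length (map-upTo (λ j → t (i + j)) n)) (length-applyUpTo _ n)

-- The bound `N` makes the search finite; equality of infinite words is not decidable.
first-difference : (f g : Inf (Fin k)) (N : ℕ) →
  (∀ j → j < N → f j ≡ g j) ⊎ (∃ λ n → (∀ j → j < n → f j ≡ g j) × f n ≢ g n)
first-difference f g zero = inj₁ λ _ ()
first-difference f g (suc N) with first-difference f g N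
... | inj₂ d = inj₂ d
... | inj₁ h with f N ≟ᶠ g N
...   | no f≢g  = inj₂ (N , h , f≢g)
...   | yes f≡g = inj₁ λ j l → extend j (m<1+n⇒m<n∨m≡n l)
  where
  extend : ∀ j → j < N ⊎ j ≡ N → f j ≡ g j
  extend j (inj₁ l)    = h j l
  extend j (inj₂ refl) = f≡g

-- Epistandard words as limits of `P`

Limit : Inf (Fin k) → Inf (Fin k) → Set
Limit s Δ = ∀ n → Pre (P (applyUpTo Δ n)) s

epistandard⇒Limit : {s Δ : Inf (Fin k)} → EpistandardDirectedBy s Δ → Limit s Δ
epistandard⇒Limit {s = s} {Δ} ep n with p , rel , pre ← ep n =
  subst (λ v → Pre v s) (trans (PalRel⇒P rel) (cong P (map-upTo Δ n))) (IsPrefixInf⇒Pre p s pre)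

P-applyUpTo-length : (Δ : Inf (Fin k)) (n : ℕ) → n ≤ length (P (applyUpTo Δ n))
P-applyUpTo-length Δ n = ≤-trans (≤-reflexive (sym (length-applyUpTo Δ n))) (P-length (applyUpTo Δ n))

P-mono : (Δ : Inf (Fin k)) {m n : ℕ} → m ≤ n → IsPrefix (P (applyUpTo Δ m)) (P (applyUpTo Δ n))
P-mono Δ {m} m≤n with d , refl ← m≤n⇒∃[o]m+o≡n m≤n =
  subst (IsPrefix _) (cong P (sym (applyUpTo-+ Δ m d))) (P-prefix-++ (applyUpTo Δ m) _)

Limit-unique : {s s′ Δ : Inf (Fin k)} → Limit s Δ → Limit s′ Δ → ∀ i → s i ≡ s′ i
Limit-unique {s = s} {s′} {Δ} lim lim′ i =
  applyUpTo-≡⁻ {f = s} {s′} _ (trans (lim (suc i)) (sym (lim′ (suc i)))) i (P-applyUpTo-length Δ (suc i))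

module _ {s Δ : Inf (Fin k)} (lim : Limit s Δ) where

  prefix-of-P : {m n : ℕ} → m ≤ n → IsPrefix (applyUpTo s m) (P (applyUpTo Δ n))
  prefix-of-P {m} {n} m≤n = applyUpTo-prefix (lim n) (≤-trans m≤n (P-applyUpTo-length Δ n))

  Factor⇒Fac : {w : List (Fin k)} → Factor w s → ∃ λ n → Fac w (P (applyUpTo Δ n))
  Factor⇒Fac {w} f with i , e ← Factor⇒Pre w s f =
    i + length w , Pre⇒Fac i e (lim (i + length w)) (P-applyUpTo-length Δ _)

  -- Every factor lies inside a palindromic prefix of `s`.
  factor-reverse : (w : List (Fin k)) → Factor w s → Factor (reverse w) s
  factor-reverse w f with n , fac ← Factor⇒Fac f =
    Fac⇒Factor (Fac-reverse (P-palindrome (applyUpTo Δ n)) fac) (lim n)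

  left-special⇒Pre : {w : List (Fin k)} {x y : Fin k} → x ≢ y → Factor (x ∷ w) s → Factor (y ∷ w) s → Pre w s
  left-special⇒Pre {w} x≢y fx fy with m , fx′ ← Factor⇒Fac fx | n , fy′ ← Factor⇒Fac fy =
    Pre-prefix (left-special-prefix (applyUpTo Δ (m ⊔ n)) w x≢y
      (Fac-prefix (P-mono Δ (m≤m⊔n m n)) fx′) (Fac-prefix (P-mono Δ (m≤n⊔m m n)) fy′)) (lim (m ⊔ n))

  right-special⇒Pre : (w : List (Fin k)) → RightSpecial w s → Pre (reverse w) s
  right-special⇒Pre w (x , y , x≢y , fx , fy) = left-special⇒Pre x≢y
    (subst (λ v → Factor v s) (reverse-∷ʳ w x) (factor-reverse _ fx))
    (subst (λ v → Factor v s) (reverse-∷ʳ w y) (factor-reverse _ fy))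

  -- The reversals of two right special factors of equal length are prefixes of `s` of equal length,
  -- hence the same word.
  episturmian : Episturmian s
  episturmian = factor-reverse , λ u v l ru rv → reverse-injective
    (trans (sym (right-special⇒Pre u ru))
      (trans (cong (applyUpTo s) (trans (length-reverse u) (trans l (sym (length-reverse v)))))
        (right-special⇒Pre v rv)))

  -- A palindromic prefix of a longer palindromic prefix is also a suffix of it, which gives a
  -- second occurrence.
  prefix-recurs : (N m : ℕ) → ∃ λ j → m < j × Pre (applyUpTo s N) (λ i → s (j + i))
  prefix-recurs N m =
    length r , +-cancelˡ-≤ (length p) _ _ (begin
      length p + suc m                ≤⟨ m≤n+m _ N ⟩
      M                               ≤⟨ P-applyUpTo-length Δ M ⟩
      length (P (applyUpTo Δ M))      ≡⟨ cong length e ⟨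
      length (r ++ reverse p)         ≡⟨ length-++ r ⟩
      length r + length (reverse p)   ≡⟨ cong (length r +_) (length-reverse p) ⟩
      length r + length p             ≡⟨ +-comm (length r) _ ⟩
      length p + length r             ∎) ,
    Pre-prefix (prefix-of-P ≤-refl)
      (Pre-++ʳ r p s (subst (λ v → Pre v s) (trans (sym e) (cong (r ++_) (P-palindrome (applyUpTo Δ N)))) (lim M)))
    where
    open ≤-Reasoning
    p = P (applyUpTo Δ N)
    -- Large enough that the word `r` in front of the suffix `p` is longer than `m`.
    M = N + (length p + suc m)
    suffix = palindrome-suffix (P-palindrome (applyUpTo Δ M)) (P-mono Δ (m≤m+n N (length p + suc m)))
    r = proj₁ suffix
    e = proj₂ suffix

  recurrent : Recurrent s
  recurrent i n m with j , m<j , e ← prefix-recurs (i + n) m =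
    j + i , ≤-trans m<j (m≤m+n j i) , (begin
      slice s (j + i) n                         ≡⟨ map-upTo _ n ⟩
      applyUpTo (λ l → s ((j + i) + l)) n       ≡⟨ applyUpTo-cong n (λ l l<n → trans (cong s (+-assoc j i l))
                                                     (agree (i + l) (+-monoʳ-< i l<n))) ⟩
      applyUpTo (λ l → s (i + l)) n             ≡⟨ map-upTo _ n ⟨
      slice s i n                               ∎)
    where
    open ≡-Reasoning
    agree : ∀ l → l < i + n → s (j + l) ≡ s l
    agree = applyUpTo-≡⁻ (i + n) (trans (cong (applyUpTo _) (sym (length-applyUpTo s (i + n)))) e)

  module _ (strict : StrictDirective Δ) where

    -- By strictness `x` is some `Δ m` with `n ≤ m`. The palindrome `P` of the first `suc m` letters
    -- begins with `P` of the first `m` letters followed by `x`, so it ends with `x` followed by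
    -- that word, which has the prefix of length `n`.
    extend-left : (x : Fin k) (n : ℕ) → Factor (x ∷ applyUpTo s n) s
    extend-left x n with m , n≤m , refl ← strict x n
      with r , e ← palindrome-suffix (P-palindrome _) (P-prefix-∷ʳ (applyUpTo Δ m) x) | r′ , e′ ← prefix-of-P n≤m =
      Fac⇒Factor {s = s} (r , r′ , (begin
        r ++ x ∷ applyUpTo s n ++ r′             ≡⟨ cong (λ z → r ++ x ∷ z) e′ ⟩
        r ++ x ∷ P (applyUpTo Δ m)               ≡⟨ cong (λ z → r ++ x ∷ z) (P-palindrome (applyUpTo Δ m)) ⟨
        r ++ x ∷ reverse (P (applyUpTo Δ m))     ≡⟨ cong (r ++_) (reverse-∷ʳ (P (applyUpTo Δ m)) x) ⟨
        r ++ reverse (P (applyUpTo Δ m) ∷ʳ x)    ≡⟨ e ⟩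
        P (applyUpTo Δ m ∷ʳ x)                   ≡⟨ cong P (applyUpTo-∷ʳ Δ m) ⟩
        P (applyUpTo Δ (suc m))                  ∎)) (lim (suc m))
      where open ≡-Reasoning

    -- Only occurrences at position 0 are new, and these are `x` followed by a prefix of `s`.
    sameFactors-cons : (x : Fin k) → SameFactors (cons x s) s
    sameFactors-cons x w = mk⇔ (to w) λ (i , e) → suc i , e
      where
      to : ∀ w → Factor w (cons x s) → Factor w s
      to w (suc i , e)    = i , e
      to [] (zero , e)    = 0 , refl
      to (y ∷ w) (zero , e) =
        subst (λ v → Factor v s) (trans (sym (map-upTo (cons x s) (suc (length w)))) e) (extend-left x (length w))

    episturmian-cons : (x : Fin k) → Episturmian (cons x s)
    episturmian-cons x =
      (λ w f → ← (proj₁ episturmian w (⇒ f))) ,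
      (λ u v l (x , y , x≢y , f , g) (x′ , y′ , x′≢y′ , f′ , g′) →
        proj₂ episturmian u v l (x , y , x≢y , ⇒ f , ⇒ g) (x′ , y′ , x′≢y′ , ⇒ f′ , ⇒ g′))
      where
      ⇒ : ∀ {w} → Factor w (cons x s) → Factor w s
      ⇒ {w} = Equivalence.to (sameFactors-cons x w)
      ← : ∀ {w} → Factor w s → Factor w (cons x s)
      ← {w} = Equivalence.from (sameFactors-cons x w)

    recurrent-cons : (x : Fin k) → Recurrent (cons x s)
    recurrent-cons x i n m
      with l , el ← Equivalence.to (sameFactors-cons x (slice (cons x s) i n))
             (i , cong (slice (cons x s) i) (length-slice (cons x s) i n))
      with j , m<j , ej ← recurrent l n m =
      suc j , m<n⇒m<1+n m<j , trans ej (trans (cong (slice s l) (sym (length-slice (cons x s) i n))) el)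

-- Minimality of `cons zero s` and the Lyndon property

zero<ᶠ : {x : Fin (suc k)} → zero ≢ x → zero {k} <ᶠ x
zero<ᶠ {x = zero} n  = ⊥-elim (n refl)
zero<ᶠ {x = suc x} n = s≤s z≤n

module _ {s Δ : Inf (Fin (suc k))} (lim : Limit s Δ) (strict : StrictDirective Δ) where

  -- If a s and u first differ at y ≠ x after a q, then a q is right special, so its reversal is a prefix
  -- of s; comparing last letters gives x = a.
  cons-minimal : (u : Inf (Fin (suc k))) → (∀ n → Factor (applyUpTo u n) s) →
    ∀ n → (∀ j → j < n → cons zero s j ≡ u j) → cons zero s n ≢ u n → cons zero s n <ᶠ u n
  cons-minimal u fac zero agree differ = zero<ᶠ differ
  cons-minimal u fac (suc n) agree x≢y = subst (_<ᶠ u (suc n)) (sym x≡0) (zero<ᶠ (x≢y ∘ trans x≡0))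
    where
    q = applyUpTo s n
    rs : RightSpecial (zero ∷ q) s
    rs = s n , u (suc n) , x≢y ,
      subst (λ v → Factor (zero ∷ v) s) (sym (applyUpTo-∷ʳ s n)) (extend-left lim strict zero (suc n)) ,
      subst (λ v → Factor v s) (trans (sym (applyUpTo-∷ʳ u (suc n)))
        (cong (_∷ʳ u (suc n)) (sym (applyUpTo-cong (suc n) agree)))) (fac (suc (suc n)))
    x≡0 : s n ≡ zero
    x≡0 = ∷ʳ-injectiveʳ q (reverse q) (begin
      q ∷ʳ s n                                   ≡⟨ applyUpTo-∷ʳ s n ⟩
      applyUpTo s (suc n)                        ≡⟨ cong (applyUpTo s) (trans (length-reverse (zero ∷ q)) (cong suc (length-applyUpTo s n))) ⟨
      applyUpTo s (length (reverse (zero ∷ q)))  ≡⟨ right-special⇒Pre lim (zero ∷ q) rs ⟩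
      reverse (zero ∷ q)                         ≡⟨ unfold-reverse zero q ⟩
      reverse q ∷ʳ zero                          ∎)
      where open ≡-Reasoning

  -- At a first difference `d` the word `cons zero s` is smaller than `t`. Its prefix of length
  -- `suc d` occurs in `t`, and not at position 0, so some proper suffix of `t` is smaller than `t`.
  Lyndon⇒cons : (t : Inf (Fin (suc k))) → SameFactors t s → InfLyndon t → ∀ n → t n ≡ cons zero s n
  Lyndon⇒cons t same lyndon n with first-difference (cons zero s) t (suc n)
  ... | inj₁ agree = sym (agree n ≤-refl)
  ... | inj₂ (d , agree , differ) with Factor⇒Pre _ t (Equivalence.from (same _) (extend-left lim strict zero d))
  ...   | i , e = contra i (applyUpTo-≡⁻ (suc d)
             (trans (cong (applyUpTo λ j → t (i + j)) (cong suc (sym (length-applyUpTo s d)))) e))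
    where
    as<t : cons zero s d <ᶠ t d
    as<t = cons-minimal t (λ n → Equivalence.to (same _) (Pre⇒Factor _ t 0 (Pre-applyUpTo t n))) d agree differ
    contra : ∀ i → (∀ j → j < suc d → t (i + j) ≡ cons zero s j) → t n ≡ cons zero s n
    contra zero occ = ⊥-elim (differ (sym (occ d ≤-refl)))
    -- Up to `d` the suffix follows `cons zero s`. So `t` cannot fall below it before `d`, where
    -- they agree, nor at `d`, where the suffix is smaller, nor later, as they would have to agree
    -- at `d`.
    contra (suc i) occ with n′ , agree′ , t<t ← lyndon i with <-cmp n′ d
    ... | tri< n′<d _ _ = ⊥-elim (<ᶠ-irrefl (trans (sym (agree n′ n′<d)) (sym (occ n′ (m<n⇒m<1+n n′<d)))) t<t)
    ... | tri≈ _ refl _ = ⊥-elim (<ᶠ-asym as<t (subst (t d <ᶠ_) (occ d ≤-refl) t<t))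
    ... | tri> _ _ d<n′ = ⊥-elim (<ᶠ-irrefl (sym (trans (agree′ d d<n′) (occ d ≤-refl))) as<t)

cons-Lyndon : {s Δ : Inf (Fin (suc (suc k)))} → Limit s Δ → StrictDirective Δ → InfLyndon (cons zero s)
cons-Lyndon {s = s} lim strict i
  -- Here `suc zero` serves as a second letter: at `j` it occurs followed by the prefix of `s` of
  -- length `suc i`.
  with j , e ← Factor⇒Pre _ s (extend-left lim strict (suc zero) (suc i))
  with first-difference (cons zero s) (λ l → s (i + l)) (suc (suc j))
... | inj₂ (n , agree , differ) = n , agree , cons-minimal lim strict (λ l → s (i + l))
        (λ n → Pre⇒Factor _ s i (Pre-applyUpTo _ n)) n agree differ
-- Agreement at 0 makes `s i` equal to `zero`. But `s i` is also the last letter of the occurrence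
-- at `j`, and agreement at `suc j` identifies that letter with the first one, `suc zero`.
... | inj₁ agree = ⊥-elim (0≢1 (begin
        zero                ≡⟨ agree 0 (s≤s z≤n) ⟩
        s (i + 0)           ≡⟨ cong s (+-identityʳ i) ⟩
        s i                 ≡⟨ occ (suc i) ≤-refl ⟨
        s (j + suc i)       ≡⟨ cong s (trans (+-suc j i) (trans (cong suc (+-comm j i)) (sym (+-suc i j)))) ⟩
        s (i + suc j)       ≡⟨ agree (suc j) ≤-refl ⟨
        s j                 ≡⟨ cong s (+-identityʳ j) ⟨
        s (j + 0)           ≡⟨ occ 0 (s≤s z≤n) ⟩
        suc zero            ∎))
  where
  open ≡-Reasoning
  0≢1 : zero ≢ suc zero
  0≢1 ()
  occ : ∀ l → l < suc (suc i) → s (j + l) ≡ cons (suc zero) s l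
  occ = applyUpTo-≡⁻ (suc (suc i)) (trans (cong (applyUpTo λ l → s (j + l)) (cong suc (sym (length-applyUpTo s (suc i))))) e)

-- The standard word of a directive word, and the spins that direct `cons zero s`

at : X → List X → ℕ → X
at d [] i            = d
at d (x ∷ w) zero    = x
at d (x ∷ w) (suc i) = at d w i

at⇒Pre : (d : Inf X) (w : List X) (s : Inf X) → (∀ i → i < length w → at (d i) w i ≡ s i) → Pre w s
at⇒Pre d [] s h      = refl
at⇒Pre d (x ∷ w) s h =
  cong₂ _∷_ (sym (h 0 (s≤s z≤n))) (at⇒Pre (d ∘ suc) w (s ∘ suc) (λ i l → h (suc i) (s≤s l)))

at-prefix : (d : X) {v w : List X} {i : ℕ} → IsPrefix v w → i < length v → at d v i ≡ at d w i
at-prefix d {x ∷ v} {i = zero}  (r , refl) l       = refl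
at-prefix d {x ∷ v} {i = suc i} (r , refl) (s≤s l) = at-prefix d {v} (r , refl) l

-- The default of at is never reached, because |P u| ≥ |u|.
standard : Inf (Fin k) → Inf (Fin k)
standard Δ i = at (Δ i) (P (applyUpTo Δ (suc i))) i

-- The words `P` are nested prefixes, so a letter may be read from any of them that is long enough.
standard-Limit : (Δ : Inf (Fin k)) → Limit (standard Δ) Δ
standard-Limit Δ n = at⇒Pre Δ (P (applyUpTo Δ n)) (standard Δ) agree
  where
  agree : ∀ i → i < length (P (applyUpTo Δ n)) → at (Δ i) (P (applyUpTo Δ n)) i ≡ standard Δ i
  agree i i<n with ≤-total n (suc i)
  ... | inj₁ n≤i = at-prefix (Δ i) (P-mono Δ n≤i) i<n
  ... | inj₂ i≤n = sym (at-prefix (Δ i) (P-mono Δ i≤n) (P-applyUpTo-length Δ (suc i)))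

-- Defined so that the tail of `shift n Δ` is `shift (suc n) Δ` by definition, which lets `P` unfold
-- to `φ` along the shifts.
shift : ℕ → Inf X → Inf X
shift zero Δ    = Δ
shift (suc n) Δ = shift n Δ ∘ suc

shift-head : (n : ℕ) (Δ : Inf X) → shift n Δ 0 ≡ Δ n
shift-head n Δ = trans (shift-+ n 0) (cong Δ (+-identityʳ n))
  where
  shift-+ : ∀ n i → shift n Δ i ≡ Δ (n + i)
  shift-+ zero i    = refl
  shift-+ (suc n) i = trans (shift-+ n (suc i)) (cong Δ (+-suc n i))

shift-strict : (n : ℕ) {Δ : Inf (Fin k)} → StrictDirective Δ → StrictDirective (shift n Δ)
shift-strict zero strict = strict
shift-strict (suc n) strict x N with suc m , s≤s N≤m , e ← shift-strict n strict x (suc N) = m , N≤m , e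

spinMin-cases : (Δ : Inf (Fin (suc k))) (n : ℕ) →
  (Δ n ≡ zero × spinMin Δ n ≡ (zero , L)) ⊎ (∃ λ x → Δ n ≡ suc x × spinMin Δ n ≡ (suc x , R))
spinMin-cases Δ n with Δ n
... | zero  = inj₁ (refl , refl)
... | suc x = inj₂ (x , refl , refl)

-- L_a(a v) = a L_a(v), while R_x(a v) = a x R_x(v) = a L_x(v) x for x ≠ a: below a leading a, both spins act as L.
spin-image : (Δ : Inf (Fin (suc k))) (n : ℕ) →
  (∀ v → concatMap (μ (spinMin Δ n)) (zero ∷ v) ≡ zero ∷ L* (Δ n) v) ⊎
  (∀ v → concatMap (μ (spinMin Δ n)) (zero ∷ v) ≡ zero ∷ φ (Δ n) v)
spin-image Δ n with spinMin-cases Δ n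
... | inj₁ (e , e′) = inj₁ λ v → begin
  concatMap (μ (spinMin Δ n)) (zero ∷ v)  ≡⟨ cong (λ D → concatMap (μ D) (zero ∷ v)) e′ ⟩
  concatMap (μ (zero , L)) (zero ∷ v)     ≡⟨ concatMap-L zero (zero ∷ v) ⟩
  L* zero (zero ∷ v)                      ≡⟨ cong (λ z → zero ∷ z ++ L* zero v) (tl-same zero) ⟩
  zero ∷ L* zero v                        ≡⟨ cong (λ c → zero ∷ L* c v) e ⟨
  zero ∷ L* (Δ n) v                       ∎
  where open ≡-Reasoning
... | inj₂ (x , e , e′) = inj₂ λ v → begin
  concatMap (μ (spinMin Δ n)) (zero ∷ v)  ≡⟨ cong (λ D → concatMap (μ D) (zero ∷ v)) e′ ⟩
  concatMap (μ (suc x , R)) (zero ∷ v)    ≡⟨ concatMap-R (suc x) (zero ∷ v) ⟩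
  R* (suc x) (zero ∷ v)                   ≡⟨ cong (_++ φ (suc x) v) (tl-diff {c = suc x} {zero} λ ()) ⟩
  zero ∷ φ (suc x) v                      ≡⟨ cong (λ c → zero ∷ φ c v) e ⟨
  zero ∷ φ (Δ n) v                        ∎
  where open ≡-Reasoning

-- Under spin `L` the image stops just before the final `Δ n` of `φ`; under spin `R` the two words
-- coincide.
spin-image-≤ : (Δ : Inf (Fin (suc k))) (n : ℕ) (v : List (Fin (suc k))) →
  IsPrefix (concatMap (μ (spinMin Δ n)) (zero ∷ v)) (zero ∷ φ (Δ n) v)
spin-image-≤ Δ n v with spin-image Δ n
... | inj₁ h = Δ n ∷ [] , trans (cong (_∷ʳ Δ n) (h v)) (cong (zero ∷_) (sym (φ-L* (Δ n) v)))
... | inj₂ h = [] , trans (++-identityʳ _) (h v)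

-- The extra letter `z` supplies the final `Δ n` missing under spin `L`, since every block of `L*`
-- begins with it.
spin-image-≥ : (Δ : Inf (Fin (suc k))) (n : ℕ) (v : List (Fin (suc k))) (z : Fin (suc k)) →
  IsPrefix (zero ∷ φ (Δ n) v) (concatMap (μ (spinMin Δ n)) (zero ∷ v ∷ʳ z))
spin-image-≥ Δ n v z with spin-image Δ n
... | inj₁ h = tl c z ++ [] , (begin
  zero ∷ φ c v ++ tl c z ++ []                          ≡⟨ cong (λ w → zero ∷ w ++ tl c z ++ []) (φ-L* c v) ⟩
  zero ∷ (L* c v ∷ʳ c) ++ tl c z ++ []                  ≡⟨ cong (zero ∷_) (++-assoc (L* c v) _ _) ⟩
  zero ∷ L* c v ++ L* c (z ∷ [])                        ≡⟨ cong (zero ∷_) (L*-++ c v (z ∷ [])) ⟨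
  zero ∷ L* c (v ∷ʳ z)                                  ≡⟨ h (v ∷ʳ z) ⟨
  concatMap (μ (spinMin Δ n)) (zero ∷ v ∷ʳ z)           ∎)
  where
  open ≡-Reasoning
  c = Δ n
... | inj₂ h = R* (Δ n) (z ∷ []) , trans (cong (zero ∷_) (sym (φ-++ᴿ (Δ n) v (z ∷ [])))) (sym (h (v ∷ʳ z)))

cons-directed : {s Δ : Inf (Fin (suc k))} → Limit s Δ → StrictDirective Δ → Directs (spinMin Δ) (cons zero s)
cons-directed {k} {s} {Δ} lim strict = T , T₀ ,
  (λ n → recurrent-cons (standard-Limit (shift n Δ)) (shift-strict n strict) zero) , image
  where
  T : ℕ → Inf (Fin (suc k))
  -- Removing `n` letters from `Δ` gives the directive word of the `n`-th desubstituted word; the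
  -- leading `zero` is kept at every level.
  T n = cons zero (standard (shift n Δ))
  T₀ : ∀ i → T 0 i ≡ cons zero s i
  T₀ zero    = refl
  T₀ (suc i) = Limit-unique (standard-Limit Δ) lim i
  image : ∀ n → IsImage (μ (spinMin Δ n)) (T (suc n)) (T n)
  image n zero    = refl
  image n (suc N) =
    subst (λ w → IsPrefixInf (concatMap (μ (spinMin Δ n)) w) (T n)) (sym (map-upTo (T (suc n)) (suc N)))
      (Pre⇒IsPrefixInf _ (T n) (Pre-prefix (spin-image-≤ Δ n v) (cong (zero ∷_) φ-pre)))
    where
    v = applyUpTo (standard (shift (suc n) Δ)) N
    φ-pre : Pre (φ (Δ n) v) (standard (shift n Δ))
    φ-pre = subst (λ c → Pre (φ c v) (standard (shift n Δ))) (shift-head n Δ)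
      (Pre-prefix {v = φ (shift n Δ 0) v} {s = standard (shift n Δ)}
        (φ-prefix (shift n Δ 0) {v} (prefix-of-P (standard-Limit (shift (suc n) Δ)) {N} ≤-refl))
        (standard-Limit (shift n Δ) (suc N)))

-- Uniqueness of the directed word

module _ {Δ : Inf (Fin (suc k))} (T : ℕ → Inf (Fin (suc k)))
  (image : ∀ n → IsImage (μ (spinMin Δ n)) (T (suc n)) (T n)) where

  head-if-zero : ∀ n → Δ n ≡ zero → T n 0 ≡ zero
  head-if-zero n e with spinMin-cases Δ n
  ... | inj₁ (_ , e′) = ∷-injectiveˡ (subst (λ w → IsPrefixInf w (T n))
    (trans (cong (λ D → concatMap (μ D) (T (suc n) 0 ∷ [])) e′) (concatMap-L zero (T (suc n) 0 ∷ []))) (image n 1))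
  ... | inj₂ (x , e₁ , _) with () ← trans (sym e₁) e

  head-step : ∀ n → T (suc n) 0 ≡ zero → T n 0 ≡ zero
  head-step n e with subst (λ y → IsPrefixInf (concatMap (μ (spinMin Δ n)) (y ∷ [])) (T n)) e (image n 1) | spin-image Δ n
  ... | im | inj₁ h = ∷-injectiveˡ (subst (λ w → IsPrefixInf w (T n)) (h []) im)
  ... | im | inj₂ h = ∷-injectiveˡ (subst (λ w → IsPrefixInf w (T n)) (h []) im)

  head-descend : ∀ d n → Δ (n + d) ≡ zero → T n 0 ≡ zero
  head-descend zero n e    = head-if-zero n (trans (cong Δ (sym (+-identityʳ n))) e)
  head-descend (suc d) n e = head-step n (head-descend d (suc n) (trans (cong Δ (sym (+-suc n d))) e))

  module _ (strict : StrictDirective Δ) where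

    -- At a later level `m` with `Δ m` equal to `zero` the spin is `L`, so `T m` begins with `zero`;
    -- each lower image preserves a leading `zero`.
    head-zero : ∀ n → T n 0 ≡ zero
    head-zero n with m , n≤m , e ← strict zero n with d , refl ← m≤n⇒∃[o]m+o≡n n≤m = head-descend d n e

    -- Induction on the prefix length, for all levels at once: if the tail of `T (suc n)` begins
    -- with `v`, then the tail of `T n` begins with `φ (Δ n) v`, which is the next `P`.
    tail-Limit : ∀ n → Limit (T n ∘ suc) (shift n Δ)
    tail-Limit n zero = refl
    tail-Limit n (suc N) = subst (λ c → Pre (φ c v) (T n ∘ suc)) (sym (shift-head n Δ)) (∷-injectiveʳ pre)
      where
      v = P (applyUpTo (shift (suc n) Δ) N)
      l = length v
      -- The letter after `zero ∷ v`, needed to complete the last block of the image.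
      z = T (suc n) (suc l)
      word : pref (T (suc n)) (suc (suc l)) ≡ zero ∷ v ∷ʳ z
      word = trans (map-upTo (T (suc n)) (suc (suc l))) (cong₂ _∷_ (head-zero (suc n))
        (trans (sym (applyUpTo-∷ʳ (T (suc n) ∘ suc) l)) (cong (_∷ʳ z) (tail-Limit (suc n) N))))
      pre : Pre (zero ∷ φ (Δ n) v) (T n)
      pre = Pre-prefix (spin-image-≥ Δ n v z) (IsPrefixInf⇒Pre _ (T n)
        (subst (λ w → IsPrefixInf (concatMap (μ (spinMin Δ n)) w) (T n)) word (image n (suc (suc l)))))

directed-unique : {s Δ : Inf (Fin (suc k))} → Limit s Δ → StrictDirective Δ →
  (t : Inf (Fin (suc k))) → Directs (spinMin Δ) t → ∀ i → t i ≡ cons zero s i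
directed-unique lim strict t (T , T₀ , _ , image) zero    = trans (sym (T₀ 0)) (head-zero T image strict 0)
directed-unique lim strict t (T , T₀ , _ , image) (suc i) =
  trans (sym (T₀ (suc i))) (Limit-unique (tail-Limit T image strict 0) lim i)

InfLyndon-cong : {t u : Inf (Fin k)} → (∀ i → t i ≡ u i) → InfLyndon u → InfLyndon t
InfLyndon-cong t≗u lyndon i with n , agree , less ← lyndon i =
  n , (λ j l → trans (t≗u j) (trans (agree j l) (sym (t≗u (suc i + j))))) ,
  subst₂ _<ᶠ_ (sym (t≗u n)) (sym (t≗u (suc i + n))) less

theorem6p11 : (m : ℕ) →
    ((t : Inf (Fin (suc (suc m)))) → StrictEpisturmian t →
    (InfLyndon t ⇔ Σ (Inf (Fin (suc (suc m)))) (λ s → Σ (Inf (Fin (suc (suc m)))) (λ Δ →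
    StrictEpistandard s Δ × (∀ i → t i ≡ cons zero s i))))) ×
    ((s Δ : Inf (Fin (suc (suc m)))) → StrictEpistandard s Δ →
    (Episturmian (cons zero s) × SameFactors (cons zero s) s × Directs (spinMin Δ) (cons zero s)) ×
    ((t′ : Inf (Fin (suc (suc m)))) → Episturmian t′ → SameFactors t′ s → Directs (spinMin Δ) t′ →
    ∀ i → t′ i ≡ cons zero s i))
theorem6p11 m =
  (λ t (_ , s , Δ , std@(strict , ep) , same) → mk⇔
    (λ lyndon → s , Δ , std , Lyndon⇒cons (epistandard⇒Limit ep) strict t same lyndon)
    (λ (s′ , Δ′ , (strict′ , ep′) , t≗) →
      InfLyndon-cong t≗ (cons-Lyndon (epistandard⇒Limit ep′) strict′))) ,
  λ s Δ (strict , ep) → let lim = epistandard⇒Limit ep in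
    (episturmian-cons lim strict zero , sameFactors-cons lim strict zero , cons-directed lim strict) ,
    λ t _ _ directs → directed-unique lim strict t directs
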